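{- Let $n,k,m$ be integers with $1\le k\le n$ and $1\le m\le n$, and let $B_{n,k}$ be any $k$-regular bipartite graph with bipartition $(X,Y)$ such that $|X|=|Y|=n$. Then $$k(m-2)+2\leq rb(B_{n,k},mK_2)\leq k(m-1)+1.$$
   Context: All graphs are simple and finite. $mK_2$ denotes a matching of size $m$ (that is, $m$ pairwise disjoint edges). An edge-coloring of a graph $G$ with $r$ colors is an arbitrary (not necessarily proper) assignment of colors to the edges of $G$ in which exactly $r$ distinct colors appear. A subgraph of an edge-colored graph is rainbow if no two of its edges have the same color. For a graph $G$ and a subgraph $H$ of $G$, the rainbow number $rb(G,H)$ is the minimum positive integer $r$ such that every edge-coloring of $G$ with $r$ colors contains a rainbow subgraph isomorphic to $H$. Equivalently, $rb(G,H)=f(G,H)+1$, where $f(G,H)$ is the maximum number of colors in an edge-coloring of $G$ with no rainbow copy of $H$ (taken to be $0$ if there is no such coloring). -}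

module Defs where

open import Data.Nat.Base using (ℕ; zero; suc; _*_; _^_; _≤_; z≤n; s≤s)
open import Data.Nat.Properties using (n<1+n)
open import Data.Fin.Base using (Fin; zero; suc; quotient; combine; finToFun; funToFin)
open import Data.Fin.Properties
  using (_≟_; all?; any?; pigeonhole; combine-injective; finToFun-funToFin; <⇒≢)
open import Data.Fin.Subset using (Subset; _∈_; ∁; ∣_∣)
open import Data.Vec.Base using (tabulate)
open import Data.Product.Base using (Σ-syntax; ∃; ∃-syntax; ∃₂; _×_; _,_; proj₁; proj₂)
open import Data.Sum.Base using (_⊎_; inj₁; inj₂)
open import Function.Base using (_∘_)
open import Function.Definitions using (Injective)
open import Relation.Binary.Core using (Rel)
open import Relation.Binary.Definitions using (Decidable; Symmetric; Irreflexive)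
open import Relation.Binary.PropositionalEquality
  using (_≡_; _≢_; refl; sym; trans; cong; cong₂; subst₂; _≗_)
open import Relation.Nullary.Decidable
  using (Dec; yes; no; does; map′; ¬?; _×-dec_; _⊎-dec_; _→-dec_)
open import Relation.Nullary.Negation using (contradiction)
open import Level using (0ℓ)

record Graph : Set₁ where
  infix 4 _~_ _~?_
  field
    order    : ℕ
    _~_      : Rel (Fin order) 0ℓ
    ~-sym    : Symmetric _~_
    ~-irrefl : Irreflexive _≡_ _~_
    _~?_     : Decidable _~_

  Vertex : Set
  Vertex = Fin order

  neighbours : Vertex → Subset order
  neighbours v = tabulate (λ w → does (v ~? w))

  degree : Vertex → ℕ
  degree v = ∣ neighbours v ∣

open Graph using (order; Vertex; degree)

IsRegular : Graph → ℕ → Set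
IsRegular G k = ∀ v → degree G v ≡ k

record IsBipartition (G : Graph) (X Y : Subset (order G)) : Set where
  open Graph G using (_~_)
  field
    complementary : Y ≡ ∁ X
    crossing      : ∀ {u v} → u ~ v → (u ∈ X × v ∈ Y) ⊎ (u ∈ Y × v ∈ X)

-- The vertices 2i and 2i + 1 are the ends of the i-th edge.
_K₂ : ℕ → Graph
m K₂ = record
  { order    = m * 2
  ; _~_      = λ u v → end u ≡ end v × u ≢ v
  ; ~-sym    = λ (p , u≢v) → sym p , u≢v ∘ sym
  ; ~-irrefl = λ u≡v (_ , u≢v) → u≢v u≡v
  ; _~?_     = λ u v → (end u ≟ end v) ×-dec ¬? (u ≟ v)
  }
  where
  end : Fin (m * 2) → Fin m
  end = quotient 2

-- Exactly r colours appear: every element of Fin r is the colour of an edge.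
-- Irrelevance of the adjacency proof makes the colour depend on the edge only.
record EdgeColouring (G : Graph) (r : ℕ) : Set where
  open Graph G using (_~_; ~-sym)
  field
    colour      : ∀ u v → .(u ~ v) → Fin r
    colour-sym  : ∀ u v (e : u ~ v) → colour u v e ≡ colour v u (~-sym e)
    colour-onto : ∀ i → ∃₂ λ u v → Σ[ e ∈ u ~ v ] colour u v e ≡ i

-- A subgraph of G isomorphic to H (not necessarily induced), given by the
-- isomorphism from H onto it.
record Copy (H G : Graph) : Set where
  private
    module G = Graph G
    module H = Graph H
  field
    vertex    : Vertex H → Vertex G
    injective : Injective _≡_ _≡_ vertex
    edge      : ∀ {u v} → u H.~ v → vertex u G.~ vertex v

SameEdge : ∀ {n} (u v u′ v′ : Fin n) → Set
SameEdge u v u′ v′ = (u ≡ u′ × v ≡ v′) ⊎ (u ≡ v′ × v ≡ u′)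

IsRainbow : ∀ {G H r} → EdgeColouring G r → Copy H G → Set
IsRainbow {G} {H} c φ =
  ∀ {u v u′ v′} (e : u ~ v) (e′ : u′ ~ v′) →
  colour (vertex u) (vertex v) (edge e) ≡ colour (vertex u′) (vertex v′) (edge e′) →
  SameEdge u v u′ v′
  where
  open Graph H using (_~_)
  open EdgeColouring c using (colour)
  open Copy φ using (vertex; edge)

HasRainbow : ∀ {G r} → EdgeColouring G r → Graph → Set
HasRainbow {G} c H = Σ[ φ ∈ Copy H G ] IsRainbow c φ

Forces : Graph → Graph → ℕ → Set
Forces G H r = (c : EdgeColouring G r) → HasRainbow c H

record IsRainbowNumber (G H : Graph) (r : ℕ) : Set where
  field
    positive : 1 ≤ r
    forces   : Forces G H r
    minimal  : ∀ s → 1 ≤ s → Forces G H s → r ≤ s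

-- The rest shows that the minimum exists: Forces G H r is decidable for r ≥ 1
-- by finite search, and holds vacuously once r exceeds the number of edges.

private
  anyFun? : ∀ {m n} {P : (Fin m → Fin n) → Set} →
            (∀ {f g} → f ≗ g → P f → P g) → (∀ f → Dec (P f)) → Dec (∃ P)
  anyFun? resp P? = map′
    (λ (i , p) → finToFun i , p)
    (λ (f , p) → funToFin f , resp (sym ∘ finToFun-funToFin f) p)
    (any? (P? ∘ finToFun))

  module _ (G H : Graph) {r : ℕ} where
    private
      module G = Graph G
      module H = Graph H

    -- A colouring as a table with arbitrary entries at non-adjacent pairs.
    Table : Set
    Table = Fin (order G) → Fin (order G) → Fin r

    IsColouring : Table → Set
    IsColouring t = (∀ u v → u G.~ v → t u v ≡ t v u)
                  × (∀ i → ∃₂ λ u v → u G.~ v × t u v ≡ i)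

    RainbowAt : Table → (Vertex H → Vertex G) → Set
    RainbowAt t f =
        (∀ u v → f u ≡ f v → u ≡ v)
      × (∀ u v → u H.~ v → f u G.~ f v)
      × (∀ u v u′ v′ → u H.~ v → u′ H.~ v′ →
           t (f u) (f v) ≡ t (f u′) (f v′) → SameEdge u v u′ v′)

    rainbowAt-resp : ∀ t {f g} → f ≗ g → RainbowAt t f → RainbowAt t g
    rainbowAt-resp t eq (inj , hom , rb) =
        (λ u v p → inj u v (trans (eq u) (trans p (sym (eq v)))))
      , (λ u v e → subst₂ G._~_ (eq u) (eq v) (hom u v e))
      , (λ u v u′ v′ e e′ p → rb u v u′ v′ e e′
           (trans (cong₂ t (eq u) (eq v))
             (trans p (sym (cong₂ t (eq u′) (eq v′))))))

    isColouring? : ∀ t → Dec (IsColouring t)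
    isColouring? t =
      all? (λ u → all? λ v → (u G.~? v) →-dec (t u v ≟ t v u))
      ×-dec all? (λ i → any? λ u → any? λ v → (u G.~? v) ×-dec (t u v ≟ i))

    rainbowAt? : ∀ t f → Dec (RainbowAt t f)
    rainbowAt? t f =
      all? (λ u → all? λ v → (f u ≟ f v) →-dec (u ≟ v))
      ×-dec all? (λ u → all? λ v → (u H.~? v) →-dec (f u G.~? f v))
      ×-dec all? (λ u → all? λ v → all? λ u′ → all? λ v′ →
        (u H.~? v) →-dec ((u′ H.~? v′) →-dec ((t (f u) (f v) ≟ t (f u′) (f v′)) →-dec
          (((u ≟ u′) ×-dec (v ≟ v′)) ⊎-dec ((u ≟ v′) ×-dec (v ≟ u′))))))

    ForcesTable : Table → Set
    ForcesTable t = IsColouring t → ∃ (RainbowAt t)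

    forcesTable? : ∀ t → Dec (ForcesTable t)
    forcesTable? t =
      isColouring? t →-dec anyFun? (rainbowAt-resp t) (rainbowAt? t)

    decode : Fin ((r ^ order G) ^ order G) → Table
    decode i u = finToFun (finToFun i u)

    encode : Table → Fin ((r ^ order G) ^ order G)
    encode t = funToFin (λ u → funToFin (t u))

    decode-encode : ∀ t u v → decode (encode t) u v ≡ t u v
    decode-encode t u v = trans
      (cong (λ i → finToFun i v) (finToFun-funToFin (λ u → funToFin (t u)) u))
      (finToFun-funToFin (t u) v)

    fromTable : ∀ t → IsColouring t → EdgeColouring G r
    fromTable t (symm , onto) = record
      { colour      = λ u v _ → t u v
      ; colour-sym  = symm
      ; colour-onto = onto
      }

    forces⇒table : Forces G H r → ∀ t → ForcesTable t
    forces⇒table F t ok =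
      let φ , rb = F (fromTable t ok)
      in Copy.vertex φ , (λ _ _ → Copy.injective φ) , (λ _ _ → Copy.edge φ) , λ _ _ _ _ → rb

    agrees⇒rainbow : (c : EdgeColouring G r) (t : Table) →
      (∀ u v (e : u G.~ v) → t u v ≡ EdgeColouring.colour c u v e) →
      ForcesTable t → HasRainbow c H
    agrees⇒rainbow c t eq F = copy , λ e e′ p →
        rb _ _ _ _ e e′ (trans (eq _ _ (hom _ _ e)) (trans p (sym (eq _ _ (hom _ _ e′)))))
      where
      open EdgeColouring c
      ok : IsColouring t
      ok = (λ u v e → trans (eq u v e) (trans (colour-sym u v e) (sym (eq v u (G.~-sym e)))))
         , (λ i → let u , v , e , p = colour-onto i in u , v , e , trans (eq u v e) p)
      f   = proj₁ (F ok)
      inj = proj₁ (proj₂ (F ok))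
      hom = proj₁ (proj₂ (proj₂ (F ok)))
      rb  = proj₂ (proj₂ (proj₂ (F ok)))
      copy : Copy H G
      copy = record { vertex = f ; injective = inj _ _ ; edge = hom _ _ }

  toTable : ∀ G {r} → EdgeColouring G (suc r) → Vertex G → Vertex G → Fin (suc r)
  toTable G c u v with Graph._~?_ G u v
  ... | yes e = EdgeColouring.colour c u v e
  ... | no  _ = zero

  toTable-agrees : ∀ G {r} (c : EdgeColouring G (suc r)) u v (e : Graph._~_ G u v) →
                   toTable G c u v ≡ EdgeColouring.colour c u v e
  toTable-agrees G c u v e with Graph._~?_ G u v
  ... | yes _ = refl
  ... | no ¬e = contradiction e ¬e

  forces? : ∀ G H r → Dec (Forces G H (suc r))
  forces? G H r = map′
    (λ F c → let t = toTable G c in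
       agrees⇒rainbow G H c (decode G H (encode G H t))
         (λ u v e → trans (decode-encode G H t u v) (toTable-agrees G c u v e))
         (F (encode G H t)))
    (λ F i → forces⇒table G H F (decode G H i))
    (all? (λ i → forcesTable? G H (decode G H i)))

  forces-vacuous : ∀ G H → Forces G H (suc (order G * order G))
  forces-vacuous G H c = contradiction i≡j (<⇒≢ i<j)
    where
    open EdgeColouring c
    ends : Fin (suc (order G * order G)) → Fin (order G * order G)
    ends i = let u , v , _ = colour-onto i in combine u v
    collision = pigeonhole (n<1+n _) ends
    i = proj₁ collision
    j = proj₁ (proj₂ collision)
    i<j = proj₁ (proj₂ (proj₂ collision))
    colour-cong : ∀ {u v u′ v′} .(e : Graph._~_ G u v) .(e′ : Graph._~_ G u′ v′) →
                  u ≡ u′ → v ≡ v′ → colour u v e ≡ colour u′ v′ e′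
    colour-cong _ _ refl refl = refl
    i≡j : i ≡ j
    i≡j =
      let u  , v  , e  , p  = colour-onto i
          u′ , v′ , e′ , p′ = colour-onto j
          u≡u′ , v≡v′ = combine-injective u v u′ v′ (proj₂ (proj₂ (proj₂ collision)))
      in trans (sym p) (trans (colour-cong e e′ u≡u′ v≡v′) p′)

  least : {P : ℕ → Set} → (∀ n → Dec (P n)) → ∀ n → P n →
          ∃[ m ] P m × (∀ k → P k → m ≤ k)
  least P? zero    p = zero , p , λ _ _ → z≤n
  least P? (suc n) p with P? zero
  ... | yes p₀ = zero , p₀ , λ _ _ → z≤n
  ... | no ¬p₀ with least (P? ∘ suc) n p
  ...   | m , pm , min = suc m , pm , λ where
            zero    p₀ → contradiction p₀ ¬p₀
            (suc k) pk → s≤s (min k pk)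

rainbowNumber-exists : ∀ G H → ∃[ r ] IsRainbowNumber G H r
rainbowNumber-exists G H with least (forces? G H) (order G * order G) (forces-vacuous G H)
... | r , F , min = suc r , record
  { positive = s≤s z≤n
  ; forces   = F
  ; minimal  = λ { (suc s) _ Fs → s≤s (min s Fs) }
  }

rb : Graph → Graph → ℕ
rb G H = proj₁ (rainbowNumber-exists G H)

rb-isRainbowNumber : ∀ G H → IsRainbowNumber G H (rb G H)
rb-isRainbowNumber G H = proj₂ (rainbowNumber-exists G H)

{-# OPTIONS --safe #-}

-- Upper bound: choose one edge of each colour. A vertex meets at most k of the
-- k (m - 1) + 1 chosen edges, so no m - 1 vertices cover them, and by König's
-- theorem m of them form a matching.
--
-- Lower bound: give distinct colours to the edges at m - 2 vertices of X and one
-- further colour to all other edges; at most m - 1 edges of a matching get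
-- distinct colours. Merging colours covers every smaller number of colours.
--
-- König's theorem is proved by induction on the edges: if two edges share an end,
-- each can be deleted in turn, and the two covers so obtained are uncrossed.
module Submission where

open import Defs
open import Data.Nat.Base using
  (ℕ; zero; suc; _+_; _*_; _⊓_; _≤_; _<_; z≤n; s≤s; s≤s⁻¹; NonZero; >-nonZero; _%_)
open import Data.Nat.Properties
  using
  (≤-reflexive; ≤-trans; ≤-total; ≤-<-trans; <-≤-trans; <⇒≱; ≰⇒>; _≤?_; n<1+n; n≤1+n; m≤m+n;
    m≤n+m; +-suc; +-comm; +-mono-≤; +-monoˡ-≤; +-monoʳ-≤; *-comm; *-monoˡ-≤; *-monoˡ-<;
    *-cancelʳ-<; m⊓n≤n; m≤n⇒m⊓n≡m; m≥n⇒m⊓n≡n; suc-injective; module ≤-Reasoning)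
open import Data.Nat.DivMod using (m≡m%n+[m/n]*n; m%n<n; m<n*o⇒m/o<n)
open import Data.Nat.Tactic.RingSolver using (solve-∀)
open import Data.Bool.Base using (true; false)
open import Data.Fin.Base using
  (Fin; zero; suc; fromℕ<; inject≤; join; splitAt; combine; quotient; remainder)
open import Data.Fin.Properties
  using
  (_≟_; pigeonhole; injective⇒≤; toℕ<n; fromℕ<-injective; fromℕ<-cong; fromℕ<-toℕ;
    inject≤-injective; splitAt-join; combine-injective; combine-remQuot; remQuot-combine; <⇒≢)
open import Data.Fin.Subset using (Subset; _∈_; _∉_; ∣_∣; _∪_; _∩_; ⊥; ⁅_⁆)
open import Data.Fin.Subset.Properties
  using (_∈?_; x∈p∩q⁺; x∈p∪q⁺; x∈⁅x⁆; ∣⁅x⁆∣≡1; ∣⊥∣≡0; x∈∁p⇒x∉p)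
open import Data.Vec.Base using ([]; _∷_; here; there)
open import Data.Vec.Properties using (lookup∘tabulate; lookup⇒[]=; []=⇒lookup)
open import Data.List.Base using (List; []; _∷_; _++_; length; lookup; allFin)
open import Data.List.Membership.Propositional renaming (_∈_ to _∈ₗ_) using (find)
open import Data.List.Membership.Propositional.Properties using (∈-∃++; ∈-allFin; ∈-lookup)
open import Data.List.Relation.Binary.Permutation.Propositional using
  (_↭_; ↭-refl; ↭-sym; ↭-trans; prep; swap)
open import Data.List.Relation.Binary.Permutation.Propositional.Properties using
  (All-resp-↭; Any-resp-↭; ↭-length; shift)
open import Data.List.Relation.Unary.All as All using (All; []; _∷_)
open import Data.List.Relation.Unary.Any using (here; there)
open import Data.List.Relation.Unary.AllPairs using (AllPairs; []; _∷_)
open import Data.Product.Base using (∃; ∃₂; _×_; _,_; proj₁; proj₂; uncurry)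
open import Data.Sum.Base as Sum using (_⊎_; inj₁; inj₂)
open import Data.Sum.Properties using (inj₁-injective; inj₂-injective)
import Data.Integer.Properties as ℤₚ
open import Function.Base using (_∘_; id)
open import Function.Definitions using (Injective)
open import Relation.Binary.PropositionalEquality
  using (_≡_; _≢_; refl; sym; trans; cong; cong₂; subst)
open import Relation.Nullary.Decidable using (Dec; yes; no; does; dec-true; _⊎-dec_)
open import Relation.Nullary.Negation using (¬_; contradiction)

-- Sizes of subsets, ranks of their members, and two facts on natural numbers.

∣p∪q∣+∣p∩q∣≡∣p∣+∣q∣ : ∀ {n} (p q : Subset n) → ∣ p ∪ q ∣ + ∣ p ∩ q ∣ ≡ ∣ p ∣ + ∣ q ∣
∣p∪q∣+∣p∩q∣≡∣p∣+∣q∣ []          []          = refl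
∣p∪q∣+∣p∩q∣≡∣p∣+∣q∣ (true  ∷ p) (true  ∷ q) = cong suc (trans (+-suc _ _)
  (trans (cong suc (∣p∪q∣+∣p∩q∣≡∣p∣+∣q∣ p q)) (sym (+-suc _ _))))
∣p∪q∣+∣p∩q∣≡∣p∣+∣q∣ (true  ∷ p) (false ∷ q) = cong suc (∣p∪q∣+∣p∩q∣≡∣p∣+∣q∣ p q)
∣p∪q∣+∣p∩q∣≡∣p∣+∣q∣ (false ∷ p) (true  ∷ q) =
  trans (cong suc (∣p∪q∣+∣p∩q∣≡∣p∣+∣q∣ p q)) (sym (+-suc _ _))
∣p∪q∣+∣p∩q∣≡∣p∣+∣q∣ (false ∷ p) (false ∷ q) = ∣p∪q∣+∣p∩q∣≡∣p∣+∣q∣ p q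

∣⁅x⁆∪p∣≤1+∣p∣ : ∀ {n} (x : Fin n) (p : Subset n) → ∣ ⁅ x ⁆ ∪ p ∣ ≤ suc ∣ p ∣
∣⁅x⁆∪p∣≤1+∣p∣ x p = begin
  ∣ ⁅ x ⁆ ∪ p ∣                   ≤⟨ m≤m+n _ _ ⟩
  ∣ ⁅ x ⁆ ∪ p ∣ + ∣ ⁅ x ⁆ ∩ p ∣   ≡⟨ ∣p∪q∣+∣p∩q∣≡∣p∣+∣q∣ ⁅ x ⁆ p ⟩
  ∣ ⁅ x ⁆ ∣ + ∣ p ∣               ≡⟨ cong (_+ ∣ p ∣) (∣⁅x⁆∣≡1 x) ⟩
  suc ∣ p ∣                       ∎
  where open ≤-Reasoning

-- The number of members of `S` below `v`. On `S` this is a bijection onto the numbers below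
-- `∣ S ∣`; it serves to number `X`, the vertices of a cover and the neighbours of a vertex.
rank : ∀ {n} → Subset n → Fin n → ℕ
rank (_     ∷ S) zero    = 0
rank (true  ∷ S) (suc v) = suc (rank S v)
rank (false ∷ S) (suc v) = rank S v

rank<∣S∣ : ∀ {n} (S : Subset n) {v} → v ∈ S → rank S v < ∣ S ∣
rank<∣S∣ (true  ∷ S) here      = s≤s z≤n
rank<∣S∣ (true  ∷ S) (there p) = s≤s (rank<∣S∣ S p)
rank<∣S∣ (false ∷ S) (there p) = rank<∣S∣ S p

rank-injective : ∀ {n} (S : Subset n) {u v} → u ∈ S → v ∈ S → rank S u ≡ rank S v → u ≡ v
rank-injective S           here      here      _  = refl
rank-injective (true  ∷ S) (there p) (there q) eq = cong suc (rank-injective S p q (suc-injective eq))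
rank-injective (false ∷ S) (there p) (there q) eq = cong suc (rank-injective S p q eq)

rank-surjective : ∀ {n} (S : Subset n) {i} → i < ∣ S ∣ → ∃ λ v → v ∈ S × rank S v ≡ i
rank-surjective (true  ∷ S) {zero}  _       = zero , here , refl
rank-surjective (true  ∷ S) {suc i} (s≤s l) =
  let v , v∈S , eq = rank-surjective S l in suc v , there v∈S , cong suc eq
rank-surjective (false ∷ S) l =
  let v , v∈S , eq = rank-surjective S l in suc v , there v∈S , eq

-- If both exceed `c`, the sum is at least `2c + 2`. The spare unit pays for the extra vertex in the
-- uncrossing of two covers.
a+b≤1+2c⇒a≤c⊎b≤c : ∀ {a b c} → a + b ≤ suc (c + c) → a ≤ c ⊎ b ≤ c
a+b≤1+2c⇒a≤c⊎b≤c {a} {b} {c} h with a ≤? c | b ≤? c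
... | yes p | _     = inj₁ p
... | _     | yes q = inj₂ q
... | no ¬p | no ¬q = contradiction h (<⇒≱ (begin
  suc (suc (c + c)) ≡⟨ cong suc (sym (+-suc c c)) ⟩
  suc c + suc c     ≤⟨ +-mono-≤ (≰⇒> ¬p) (≰⇒> ¬q) ⟩
  a + b             ∎))
  where open ≤-Reasoning

-- Truncation at `c` identifies only numbers that have reached `c`; in the lower bound these are the
-- ranks whose edges share the last colour.
⊓-cancelʳ : ∀ {a b c} → a ⊓ c ≡ b ⊓ c → a ≡ b ⊎ (c ≤ a × c ≤ b)
⊓-cancelʳ {a} {b} {c} eq with ≤-total a c | ≤-total b c
... | inj₁ p | inj₁ q = inj₁ (trans (sym (m≤n⇒m⊓n≡m p)) (trans eq (m≤n⇒m⊓n≡m q)))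
... | inj₂ p | inj₂ q = inj₂ (p , q)
... | inj₁ p | inj₂ q = inj₂ (≤-reflexive (sym (trans (sym (m≤n⇒m⊓n≡m p)) (trans eq (m≥n⇒m⊓n≡n q)))) , q)
... | inj₂ p | inj₁ q = inj₂ (p , ≤-reflexive (trans (sym (m≥n⇒m⊓n≡n p)) (trans eq (m≤n⇒m⊓n≡m q))))

-- König's theorem for families of edges with two end maps.

module _ {I : Set} {a b} (f : I → Fin a) (g : I → Fin b) where

  -- An index `i` stands for an edge from `f i` on one side to `g i` on the other. The sides are
  -- kept apart, and parallel edges are allowed.
  Disjoint : I → I → Set
  Disjoint i j = f i ≢ f j × g i ≢ g j

  Matching : List I → Set
  Matching = AllPairs Disjoint

  Covers : Subset a → Subset b → I → Set
  Covers P Q i = f i ∈ P ⊎ g i ∈ Q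

  covers? : ∀ P Q i → Dec (Covers P Q i)
  covers? P Q i = (f i ∈? P) ⊎-dec (g i ∈? Q)

  HasCover : List I → ℕ → Set
  HasCover E μ = ∃₂ λ P Q → All (Covers P Q) E × ∣ P ∣ + ∣ Q ∣ ≤ μ

  -- If neither given cover extends, then f i lies in neither P₁ nor P₂, so
  -- g j ∈ Q₁ and g i ∈ Q₂. Hence both (P₁ ∩ P₂ , Q₁ ∪ Q₂) and
  -- (⁅ f i ⁆ ∪ P₁ ∪ P₂ , Q₁ ∩ Q₂) cover everything, and their sizes add up to at most 2μ + 1.
  uncross : ∀ {i j R μ} → f i ≡ f j →
            HasCover (j ∷ R) μ → HasCover (i ∷ R) μ → HasCover (i ∷ j ∷ R) μ
  uncross {i} {j} {R} {μ} fi≡fj (P₁ , Q₁ , j₁ ∷ R₁ , l₁) (P₂ , Q₂ , i₂ ∷ R₂ , l₂)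
    with covers? P₁ Q₁ i | covers? P₂ Q₂ j
  ... | yes i₁ | _      = P₁ , Q₁ , i₁ ∷ j₁ ∷ R₁ , l₁
  ... | no  _  | yes j₂ = P₂ , Q₂ , i₂ ∷ j₂ ∷ R₂ , l₂
  ... | no ¬i₁ | no ¬j₂ = choose (a+b≤1+2c⇒a≤c⊎b≤c {c = μ} total)
    where
    meet : All (Covers (P₁ ∩ P₂) (Q₁ ∪ Q₂)) (i ∷ j ∷ R)
    meet = inj₂ (x∈p∪q⁺ (inj₂ (Sum.[ (λ p → contradiction (inj₁ (subst (_∈ P₂) fi≡fj p)) ¬j₂) , id ] i₂)))
         ∷ inj₂ (x∈p∪q⁺ (inj₁ (Sum.[ (λ p → contradiction (inj₁ (subst (_∈ P₁) (sym fi≡fj) p)) ¬i₁) , id ] j₁)))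
         ∷ All.zipWith (λ where
             (inj₁ p , inj₁ q) → inj₁ (x∈p∩q⁺ (p , q))
             (inj₂ p , _)      → inj₂ (x∈p∪q⁺ (inj₁ p))
             (_      , inj₂ q) → inj₂ (x∈p∪q⁺ (inj₂ q))) (R₁ , R₂)
    join′ : All (Covers (⁅ f i ⁆ ∪ (P₁ ∪ P₂)) (Q₁ ∩ Q₂)) (i ∷ j ∷ R)
    join′ = inj₁ (x∈p∪q⁺ (inj₁ (x∈⁅x⁆ (f i))))
          ∷ inj₁ (x∈p∪q⁺ (inj₁ (subst (_∈ ⁅ f i ⁆) fi≡fj (x∈⁅x⁆ (f i)))))
          ∷ All.zipWith (λ where
              (inj₁ p , _)      → inj₁ (x∈p∪q⁺ (inj₂ (x∈p∪q⁺ (inj₁ p))))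
              (_      , inj₁ q) → inj₁ (x∈p∪q⁺ (inj₂ (x∈p∪q⁺ (inj₂ q))))
              (inj₂ p , inj₂ q) → inj₂ (x∈p∩q⁺ (p , q))) (R₁ , R₂)
    regroup : ∀ p q r s → (p + q) + (suc r + s) ≡ suc ((r + p) + (q + s))
    regroup = solve-∀
    regroup′ : ∀ p q r s → (p + q) + (r + s) ≡ (p + r) + (q + s)
    regroup′ = solve-∀
    open ≤-Reasoning
    total : (∣ P₁ ∩ P₂ ∣ + ∣ Q₁ ∪ Q₂ ∣) + (∣ ⁅ f i ⁆ ∪ (P₁ ∪ P₂) ∣ + ∣ Q₁ ∩ Q₂ ∣) ≤ suc (μ + μ)
    total = begin
      (∣ P₁ ∩ P₂ ∣ + ∣ Q₁ ∪ Q₂ ∣) + (∣ ⁅ f i ⁆ ∪ (P₁ ∪ P₂) ∣ + ∣ Q₁ ∩ Q₂ ∣)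
        ≤⟨ +-monoʳ-≤ (∣ P₁ ∩ P₂ ∣ + ∣ Q₁ ∪ Q₂ ∣) (+-monoˡ-≤ ∣ Q₁ ∩ Q₂ ∣ (∣⁅x⁆∪p∣≤1+∣p∣ (f i) (P₁ ∪ P₂))) ⟩
      (∣ P₁ ∩ P₂ ∣ + ∣ Q₁ ∪ Q₂ ∣) + (suc ∣ P₁ ∪ P₂ ∣ + ∣ Q₁ ∩ Q₂ ∣)
        ≡⟨ regroup (∣ P₁ ∩ P₂ ∣) (∣ Q₁ ∪ Q₂ ∣) (∣ P₁ ∪ P₂ ∣) (∣ Q₁ ∩ Q₂ ∣) ⟩
      suc ((∣ P₁ ∪ P₂ ∣ + ∣ P₁ ∩ P₂ ∣) + (∣ Q₁ ∪ Q₂ ∣ + ∣ Q₁ ∩ Q₂ ∣))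
        ≡⟨ cong suc (cong₂ _+_ (∣p∪q∣+∣p∩q∣≡∣p∣+∣q∣ P₁ P₂) (∣p∪q∣+∣p∩q∣≡∣p∣+∣q∣ Q₁ Q₂)) ⟩
      suc ((∣ P₁ ∣ + ∣ P₂ ∣) + (∣ Q₁ ∣ + ∣ Q₂ ∣))
        ≡⟨ cong suc (regroup′ (∣ P₁ ∣) (∣ P₂ ∣) (∣ Q₁ ∣) (∣ Q₂ ∣)) ⟩
      suc ((∣ P₁ ∣ + ∣ Q₁ ∣) + (∣ P₂ ∣ + ∣ Q₂ ∣))
        ≤⟨ s≤s (+-mono-≤ l₁ l₂) ⟩
      suc (μ + μ) ∎
    choose : ∣ P₁ ∩ P₂ ∣ + ∣ Q₁ ∪ Q₂ ∣ ≤ μ ⊎ ∣ ⁅ f i ⁆ ∪ (P₁ ∪ P₂) ∣ + ∣ Q₁ ∩ Q₂ ∣ ≤ μ →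
             HasCover (i ∷ j ∷ R) μ
    choose (inj₁ l) = P₁ ∩ P₂ , Q₁ ∪ Q₂ , meet , l
    choose (inj₂ l) = ⁅ f i ⁆ ∪ (P₁ ∪ P₂) , Q₁ ∩ Q₂ , join′ , l

-- Exchanging the sides reduces a clash at a `g`-end to `uncross`, which treats `f`-ends.
transpose : ∀ {I : Set} {a b} {f : I → Fin a} {g : I → Fin b} {E μ} →
            HasCover f g E μ → HasCover g f E μ
transpose (P , Q , E , l) = Q , P , All.map Sum.swap E , ≤-trans (≤-reflexive (+-comm (∣ Q ∣) (∣ P ∣))) l

module _ {I : Set} {a b} {f : I → Fin a} {g : I → Fin b} where

  -- All the `f`-ends suffice. For a matching this is already the cover that `könig` asks for.
  trivialCover : ∀ E → HasCover f g E (length E)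
  trivialCover []      = ⊥ , ⊥ , [] , ≤-reflexive (cong₂ _+_ (∣⊥∣≡0 a) (∣⊥∣≡0 b))
  trivialCover (i ∷ E) with trivialCover E
  ... | P , Q , E∈ , l =
    ⁅ f i ⁆ ∪ P , Q
    , inj₁ (x∈p∪q⁺ (inj₁ (x∈⁅x⁆ (f i)))) ∷ All.map (Sum.map₁ (x∈p∪q⁺ ∘ inj₂)) E∈
    , ≤-trans (+-monoˡ-≤ ∣ Q ∣ (∣⁅x⁆∪p∣≤1+∣p∣ (f i) P)) (s≤s l)

  disjoint? : ∀ i j → Disjoint f g i j ⊎ (f i ≡ f j ⊎ g i ≡ g j)
  disjoint? i j with f i ≟ f j | g i ≟ g j
  ... | yes p | _     = inj₂ (inj₁ p)
  ... | no _  | yes q = inj₂ (inj₂ q)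
  ... | no ¬p | no ¬q = inj₁ (¬p , ¬q)

  -- The clashing pair is brought to the front so that either of its edges can be deleted.
  matching-or-clash : ∀ E → Matching f g E ⊎
    (∃₂ λ i j → ∃ λ R → (f i ≡ f j ⊎ g i ≡ g j) × E ↭ i ∷ j ∷ R)
  matching-or-clash [] = inj₁ []
  matching-or-clash (i ∷ E) with All.decide (disjoint? i) E
  ... | inj₂ clash =
    let j , j∈E , c = find clash
        ys , zs , eq = ∈-∃++ j∈E
    in inj₂ (i , j , _ , c , prep i (subst (_↭ (j ∷ ys ++ zs)) (sym eq) (shift j ys zs)))
  ... | inj₁ d with matching-or-clash E
  ...   | inj₁ m = inj₁ (d ∷ m)
  ...   | inj₂ (j , k , R , c , p) = inj₂ (j , k , i ∷ R , c ,
          ↭-trans (prep i p) (↭-trans (swap i j ↭-refl) (prep j (swap i k ↭-refl))))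

  könig : ∀ E → ∃ λ M → All (_∈ₗ E) M × Matching f g M × HasCover f g E (length M)
  könig E = go (length E) E refl
    where
    go : ∀ n E → length E ≡ n → ∃ λ M → All (_∈ₗ E) M × Matching f g M × HasCover f g E (length M)
    go n E len with matching-or-clash E
    ... | inj₁ m = E , All.tabulate id , m , trivialCover E
    go zero E len | inj₂ (i , j , R , c , p) with () ← trans (sym (↭-length p)) len
    go (suc n) E len | inj₂ (i , j , R , c , p)
      with lenR ← suc-injective (trans (sym (↭-length p)) len)
      with M₁ , M₁⊆ , m₁ , c₁ ← go n (j ∷ R) lenR
         | M₂ , M₂⊆ , m₂ , c₂ ← go n (i ∷ R) lenR
      -- The longer of the two matchings is kept, and the cover belonging to the shorter one is
      -- weakened to the same bound, as `uncross` requires a common `μ`.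
      = Sum.[ (λ l → M₂ , M₂⊆E , m₂ , combined (weaken l c₁) c₂)
            , (λ l → M₁ , M₁⊆E , m₁ , combined c₁ (weaken l c₂)) ]
            (≤-total (length M₁) (length M₂))
      where
      weaken : ∀ {F μ ν} → μ ≤ ν → HasCover f g F μ → HasCover f g F ν
      weaken l (P , Q , F , l′) = P , Q , F , ≤-trans l′ l
      M₁⊆E : All (_∈ₗ E) M₁
      M₁⊆E = All.map (Any-resp-↭ (↭-sym p) ∘ there) M₁⊆
      M₂⊆E : All (_∈ₗ E) M₂
      M₂⊆E = All.map (Any-resp-↭ (↭-trans (swap j i ↭-refl) (↭-sym p)) ∘ there) M₂⊆
      combined : ∀ {μ} → HasCover f g (j ∷ R) μ → HasCover f g (i ∷ R) μ → HasCover f g E μ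
      combined d₁ d₂ = permute (Sum.[ (λ e → uncross f g e d₁ d₂)
        , (λ e → transpose (uncross g f e (transpose d₁) (transpose d₂))) ] c)
        where
        permute : ∀ {μ} → HasCover f g (i ∷ j ∷ R) μ → HasCover f g E μ
        permute (P , Q , F , l) = P , Q , All-resp-↭ (↭-sym p) F , l

  matching-lookup-injective : ∀ {M} → Matching f g M → ∀ {s t} →
    f (lookup M s) ≡ f (lookup M t) ⊎ g (lookup M s) ≡ g (lookup M t) → s ≡ t
  matching-lookup-injective {_ ∷ _} _ {zero} {zero} _ = refl
  matching-lookup-injective {_ ∷ _} (d ∷ m) {zero} {suc t} (inj₁ e) =
    contradiction e (proj₁ (All.lookup d (∈-lookup t)))
  matching-lookup-injective {_ ∷ _} (d ∷ m) {zero} {suc t} (inj₂ e) =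
    contradiction e (proj₂ (All.lookup d (∈-lookup t)))
  matching-lookup-injective {_ ∷ _} (d ∷ m) {suc s} {zero} (inj₁ e) =
    contradiction (sym e) (proj₁ (All.lookup d (∈-lookup s)))
  matching-lookup-injective {_ ∷ _} (d ∷ m) {suc s} {zero} (inj₂ e) =
    contradiction (sym e) (proj₂ (All.lookup d (∈-lookup s)))
  matching-lookup-injective {_ ∷ _} (d ∷ m) {suc s} {suc t} e =
    cong suc (matching-lookup-injective m e)

-- Counting the edges that a set of vertices can cover.

module _ (G : Graph) where
  open Graph G

  ~⇒∈neighbours : ∀ {u v} → u ~ v → v ∈ neighbours u
  ~⇒∈neighbours {u} {v} e = lookup⇒[]= v _ (trans (lookup∘tabulate _ v) (dec-true (u ~? v) e))

  ∈neighbours⇒~ : ∀ {u v} → v ∈ neighbours u → u ~ v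
  ∈neighbours⇒~ {u} {v} v∈ with u ~? v | trans (sym (lookup∘tabulate (λ w → does (u ~? w)) v)) ([]=⇒lookup v∈)
  ... | yes e | _ = e

  -- Each edge is encoded by one covering end together with the rank of the other end among the
  -- neighbours of that end. There are `(∣ P ∣ + ∣ Q ∣) * k` codes, and a code determines both ends,
  -- hence the index.
  cover-bound : ∀ {k} → (∀ v → degree v ≤ k) →
    ∀ {r} {f g : Fin r → Vertex} → (∀ i → f i ~ g i) →
    (∀ {i j} → f i ≡ f j → g i ≡ g j → i ≡ j) →
    ∀ {μ} → HasCover f g (allFin r) μ → r ≤ μ * k
  cover-bound {k} deg≤k {r} {f} {g} edge distinct {μ} (P , Q , covers , l) =
    ≤-trans (injective⇒≤ code-injective) (*-monoˡ-≤ k l)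
    where
    nth : ∀ {u v} → u ~ v → Fin k
    nth {u} {v} e = fromℕ< (≤-trans (rank<∣S∣ (neighbours u) (~⇒∈neighbours e)) (deg≤k u))
    nth-injective : ∀ {u v u′ v′} {e : u ~ v} {e′ : u′ ~ v′} → u ≡ u′ → nth e ≡ nth e′ → v ≡ v′
    nth-injective {u} {e = e} {e′} refl eq =
      rank-injective (neighbours u) (~⇒∈neighbours e) (~⇒∈neighbours e′) (fromℕ<-injective _ _ _ _ eq)
    Code : Set
    Code = (Fin ∣ P ∣ ⊎ Fin ∣ Q ∣) × Fin k
    code : ∀ {i} → Covers f g P Q i → Code
    code {i} (inj₁ p) = inj₁ (fromℕ< (rank<∣S∣ P p)) , nth (edge i)
    code {i} (inj₂ q) = inj₂ (fromℕ< (rank<∣S∣ Q q)) , nth (~-sym (edge i))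
    code-injective′ : ∀ {i j} (c : Covers f g P Q i) (d : Covers f g P Q j) →
      proj₁ (code c) ≡ proj₁ (code d) → proj₂ (code c) ≡ proj₂ (code d) → i ≡ j
    code-injective′ {i} {j} (inj₁ p) (inj₁ p′) eq eq′ =
      distinct f≡ (nth-injective {e = edge i} {edge j} f≡ eq′)
      where f≡ = rank-injective P p p′ (fromℕ<-injective _ _ _ _ (inj₁-injective eq))
    code-injective′ {i} {j} (inj₂ q) (inj₂ q′) eq eq′ =
      distinct (nth-injective {e = ~-sym (edge i)} {~-sym (edge j)} g≡ eq′) g≡
      where g≡ = rank-injective Q q q′ (fromℕ<-injective _ _ _ _ (inj₂-injective eq))
    code-injective′ (inj₁ _) (inj₂ _) ()
    code-injective′ (inj₂ _) (inj₁ _) ()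
    covered : ∀ i → Covers f g P Q i
    covered i = All.lookup covers (∈-allFin i)
    toFin : Code → Fin ((∣ P ∣ + ∣ Q ∣) * k)
    toFin (s , n) = combine (join (∣ P ∣) (∣ Q ∣) s) n
    code-injective : Injective _≡_ _≡_ (toFin ∘ code ∘ covered)
    code-injective {i} {j} eq =
      let eq₁ , eq₂ = combine-injective (join (∣ P ∣) (∣ Q ∣) (proj₁ (code (covered i)))) _ _ _ eq
      in code-injective′ (covered i) (covered j)
           (trans (sym (splitAt-join (∣ P ∣) (∣ Q ∣) _)) (trans (cong (splitAt ∣ P ∣) eq₁) (splitAt-join (∣ P ∣) (∣ Q ∣) _)))
           eq₂

-- Edges of `m K₂`: the quotient by 2 numbers the edge, the remainder its end.

quotient-remainder-injective : ∀ {m} {u v : Fin (m * 2)} →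
  quotient {m} 2 u ≡ quotient {m} 2 v → remainder {m} 2 u ≡ remainder {m} 2 v → u ≡ v
quotient-remainder-injective {m} {u} {v} q r =
  trans (sym (combine-remQuot {m} 2 u)) (trans (cong₂ combine q r) (combine-remQuot {m} 2 v))


Fin2-pair-unique : ∀ (r s r′ s′ : Fin 2) → r ≢ s → r′ ≢ s′ → SameEdge r s r′ s′
Fin2-pair-unique zero       zero       _          _          n _  = contradiction refl n
Fin2-pair-unique (suc zero) (suc zero) _          _          n _  = contradiction refl n
Fin2-pair-unique _          _          zero       zero       _ n′ = contradiction refl n′
Fin2-pair-unique _          _          (suc zero) (suc zero) _ n′ = contradiction refl n′
Fin2-pair-unique zero       (suc zero) zero       (suc zero) _ _  = inj₁ (refl , refl)
Fin2-pair-unique zero       (suc zero) (suc zero) zero       _ _  = inj₂ (refl , refl)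
Fin2-pair-unique (suc zero) zero       zero       (suc zero) _ _  = inj₂ (refl , refl)
Fin2-pair-unique (suc zero) zero       (suc zero) zero       _ _  = inj₁ (refl , refl)

module _ {m : ℕ} where
  open Graph (m K₂)

  remainder-distinct : ∀ {u v} → u ~ v → remainder {m} 2 u ≢ remainder {m} 2 v
  remainder-distinct (q , u≢v) r = u≢v (quotient-remainder-injective {m} q r)

  -- The two ends of an edge have distinct remainders, and these exhaust `Fin 2`; so the edge number
  -- fixes the pair of ends up to order.
  K₂-edge-unique : ∀ {u v u′ v′} → u ~ v → u′ ~ v′ →
    quotient {m} 2 u ≡ quotient {m} 2 u′ → SameEdge u v u′ v′
  K₂-edge-unique e@(uv , _) e′@(u′v′ , _) q
    with Fin2-pair-unique _ _ _ _ (remainder-distinct e) (remainder-distinct e′)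
  ... | inj₁ (r , s) = inj₁ ( quotient-remainder-injective {m} q r
                            , quotient-remainder-injective {m} (trans (sym uv) (trans q u′v′)) s)
  ... | inj₂ (r , s) = inj₂ ( quotient-remainder-injective {m} (trans q u′v′) r
                            , quotient-remainder-injective {m} (trans (sym uv) q) s)

  K₂-pair : ∀ i → combine {m} i zero ~ combine i (suc zero)
  K₂-pair i = trans (cong proj₁ (remQuot-combine i zero)) (sym (cong proj₁ (remQuot-combine {m} i (suc zero))))
            , λ eq → contradiction (proj₂ (combine-injective i _ i _ eq)) λ ()

-- Bipartite graphs and the upper bound.

module _ {B : Graph} {X Y : Subset (Graph.order B)} (bip : IsBipartition B X Y) where
  open Graph B
  open IsBipartition bip

  X∩Y-empty : ∀ {v} → v ∈ X → v ∉ Y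
  X∩Y-empty v∈X v∈Y = x∈∁p⇒x∉p (subst (_ ∈_) complementary v∈Y) v∈X

  -- Any matching among representatives of different colours is rainbow. The cover from `könig`
  -- gives `r ≤ length M * k`, and with `k * m < r` this yields `m < length M`.
  rainbow-matching : ∀ {m k r} → (∀ v → degree v ≤ k) → k * m < r → Forces B (suc m K₂) r
  rainbow-matching {m} {k} {r} deg≤k km<r c = copy , rainbow
    where
    open EdgeColouring c

    -- Each representative is turned to run from `X` to `Y`, so that no `f`-end equals a `g`-end;
    -- `end-injective` relies on this.
    representative : ∀ i → ∃₂ λ x y → (x ∈ X × y ∈ Y) × ∃ λ (e : x ~ y) → colour x y e ≡ i
    representative i with u , v , e , col ← colour-onto i with crossing e
    ... | inj₁ (u∈X , v∈Y) = u , v , (u∈X , v∈Y) , e , col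
    ... | inj₂ (u∈Y , v∈X) = v , u , (v∈X , u∈Y) , ~-sym e , trans (sym (colour-sym u v e)) col

    f g : Fin r → Vertex
    f i = proj₁ (representative i)
    g i = proj₁ (proj₂ (representative i))
    f∈X : ∀ i → f i ∈ X
    f∈X i = proj₁ (proj₁ (proj₂ (proj₂ (representative i))))
    g∈Y : ∀ i → g i ∈ Y
    g∈Y i = proj₂ (proj₁ (proj₂ (proj₂ (representative i))))
    f~g : ∀ i → f i ~ g i
    f~g i = proj₁ (proj₂ (proj₂ (proj₂ (representative i))))
    colour-f-g : ∀ i → colour (f i) (g i) (f~g i) ≡ i
    colour-f-g i = proj₂ (proj₂ (proj₂ (proj₂ (representative i))))

    colour-cong : ∀ {u v u′ v′} .(e : u ~ v) .(e′ : u′ ~ v′) →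
                  u ≡ u′ → v ≡ v′ → colour u v e ≡ colour u′ v′ e′
    colour-cong _ _ refl refl = refl

    distinct : ∀ {i j} → f i ≡ f j → g i ≡ g j → i ≡ j
    distinct {i} {j} p q =
      trans (sym (colour-f-g i)) (trans (colour-cong (f~g i) (f~g j) p q) (colour-f-g j))

    M = proj₁ (könig {f = f} {g} (allFin r))
    matching : Matching f g M
    matching = proj₁ (proj₂ (proj₂ (könig (allFin r))))
    cover : HasCover f g (allFin r) (length M)
    cover = proj₂ (proj₂ (proj₂ (könig (allFin r))))

    m<∣M∣ : m < length M
    m<∣M∣ = *-cancelʳ-< _ m (length M) (<-≤-trans (subst (_< r) (*-comm k m) km<r)
      (cover-bound B deg≤k f~g distinct cover))

    edgeAt : Fin (suc m) → Fin r
    edgeAt a = lookup M (inject≤ a m<∣M∣)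
    edgeAt-injective : ∀ {a b} → f (edgeAt a) ≡ f (edgeAt b) ⊎ g (edgeAt a) ≡ g (edgeAt b) → a ≡ b
    edgeAt-injective e = inject≤-injective m<∣M∣ m<∣M∣ _ _ (matching-lookup-injective matching e)

    end : Fin r → Fin 2 → Vertex
    end i zero    = f i
    end i (suc _) = g i

    end-injective : ∀ {a b} s t → end (edgeAt a) s ≡ end (edgeAt b) t → a ≡ b × s ≡ t
    end-injective zero       zero       eq = edgeAt-injective (inj₁ eq) , refl
    end-injective zero       (suc _)    eq = contradiction (g∈Y _) (X∩Y-empty (subst (_∈ X) eq (f∈X _)))
    end-injective (suc _)    zero       eq = contradiction (g∈Y _) (X∩Y-empty (subst (_∈ X) (sym eq) (f∈X _)))
    end-injective (suc zero) (suc zero) eq = edgeAt-injective (inj₂ eq) , refl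

    end-edge : ∀ i {s t} → s ≢ t → ∃ λ (e : end i s ~ end i t) → colour (end i s) (end i t) e ≡ i
    end-edge i {zero}     {zero}     n = contradiction refl n
    end-edge i {zero}     {suc zero} n = f~g i , colour-f-g i
    end-edge i {suc zero} {zero}     n =
      ~-sym (f~g i) , trans (sym (colour-sym (f i) (g i) (f~g i))) (colour-f-g i)
    end-edge i {suc zero} {suc zero} n = contradiction refl n

    vertex : Fin (suc m * 2) → Vertex
    vertex w = end (edgeAt (quotient {suc m} 2 w)) (remainder {suc m} 2 w)

    vertex-edge : ∀ {u v} → Graph._~_ (suc m K₂) u v →
      ∃ λ (e : vertex u ~ vertex v) → colour (vertex u) (vertex v) e ≡ edgeAt (quotient {suc m} 2 u)
    vertex-edge {u} {v} e@(q , _) =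
      -- Both ends of the edge have the same quotient only up to `q`, so the edge at index
      -- `edgeAt a` is transported along it.
      subst (λ a → ∃ λ (e : vertex u ~ end (edgeAt a) (remainder {suc m} 2 v)) →
                   colour (vertex u) (end (edgeAt a) (remainder {suc m} 2 v)) e ≡ edgeAt (quotient {suc m} 2 u))
            q (end-edge _ (remainder-distinct {suc m} e))

    copy : Copy (suc m K₂) B
    copy = record
      { vertex    = vertex
      ; injective = λ {u} {v} eq →
          let q , r = end-injective (remainder {suc m} 2 u) (remainder {suc m} 2 v) eq
          in quotient-remainder-injective {suc m} q r
      ; edge      = proj₁ ∘ vertex-edge
      }

    rainbow : IsRainbow c copy
    -- The colour of an edge of the copy is its own index under `edgeAt`, so equal colours force
    -- equal edge numbers.
    rainbow e e′ eq = K₂-edge-unique {suc m} e e′ (edgeAt-injective (inj₁ (cong f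
      (trans (sym (proj₂ (vertex-edge e))) (trans eq (proj₂ (vertex-edge e′)))))))

  -- The lower bound: colourings without a rainbow matching.

  module _ {k : ℕ} .{{_ : NonZero k}} (regular : IsRegular B k) where

    nbr<k : ∀ {u v} → u ~ v → rank (neighbours u) v < k
    nbr<k {u} {v} e = subst (rank (neighbours u) v <_) (regular u) (rank<∣S∣ (neighbours u) (~⇒∈neighbours B e))

    -- Two ranks read as digits to base `k`: the edges at the member of `X` of rank `a` are numbered
    -- from `a * k` to `a * k + k - 1`.
    code : Vertex → Vertex → ℕ
    code x y = rank (neighbours x) y + rank X x * k

    -- Division of `i` by `k` yields the two ranks; regularity supplies a neighbour for every
    -- remainder.
    code-surjective : ∀ {i} → i < ∣ X ∣ * k → ∃₂ λ x y → x ∈ X × x ~ y × code x y ≡ i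
    code-surjective {i} i< =
      let x , x∈X , p = rank-surjective X (m<n*o⇒m/o<n i<)
          y , y∈  , q = rank-surjective (neighbours x) (subst (i % k <_) (sym (regular x)) (m%n<n i k))
      in x , y , x∈X , ∈neighbours⇒~ B y∈
         , trans (cong₂ (λ a b → a + b * k) q p) (sym (m≡m%n+[m/n]*n i k))

    -- `code` is not symmetric, so the end in `X` is put first to make the colour independent of the
    -- order of the ends.
    orient : Vertex → Vertex → Vertex × Vertex
    orient u v with u ∈? X
    ... | yes _ = u , v
    ... | no  _ = v , u

    orient-sym : ∀ {u v} → u ~ v → orient u v ≡ orient v u
    orient-sym {u} {v} e with u ∈? X | v ∈? X | crossing e
    ... | yes u∈X | yes v∈X | inj₁ (_ , v∈Y) = contradiction v∈Y (X∩Y-empty v∈X)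
    ... | yes u∈X | yes v∈X | inj₂ (u∈Y , _) = contradiction u∈Y (X∩Y-empty u∈X)
    ... | yes _   | no _    | _              = refl
    ... | no _    | yes _   | _              = refl
    ... | no u∉X  | no _    | inj₁ (u∈X , _) = contradiction u∈X u∉X
    ... | no _    | no v∉X  | inj₂ (_ , v∈X) = contradiction v∈X v∉X

    orient-∈ : ∀ {u v} → u ∈ X → orient u v ≡ (u , v)
    orient-∈ {u} u∈X with u ∈? X
    ... | yes _  = refl
    ... | no u∉X = contradiction u∈X u∉X

    orient-X : ∀ {u v} → u ~ v → proj₁ (orient u v) ∈ X
    orient-X {u} {v} e with u ∈? X | crossing e
    ... | yes u∈X | _              = u∈X
    ... | no u∉X  | inj₁ (u∈X , _) = contradiction u∈X u∉X
    ... | no _    | inj₂ (_ , v∈X) = v∈X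

    orient-end : ∀ u v → proj₁ (orient u v) ≡ u ⊎ proj₁ (orient u v) ≡ v
    orient-end u v with u ∈? X
    ... | yes _ = inj₁ refl
    ... | no  _ = inj₂ refl

    -- For t = a * k the edges meeting the first a vertices of X get distinct
    -- colours below t, and all the other edges get colour t.
    truncatedColour : ℕ → Vertex → Vertex → ℕ
    truncatedColour t u v = uncurry code (orient u v) ⊓ t

    -- Every `i ≤ t` is the code of some edge because `t < ∣ X ∣ * k`, and truncation at `t` leaves
    -- it unchanged. Hence all `suc t` colours appear.
    colouring : ∀ {t} → t < ∣ X ∣ * k → EdgeColouring B (suc t)
    colouring {t} t< = record
      { colour      = λ u v _ → fromℕ< (s≤s (m⊓n≤n (uncurry code (orient u v)) t))
      ; colour-sym  = λ u v e → fromℕ<-cong _ _ (cong (λ xy → uncurry code xy ⊓ t) (orient-sym e)) _ _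
      ; colour-onto = λ i →
          let i≤t = s≤s⁻¹ (toℕ<n i)
              x , y , x∈X , e , eq = code-surjective (≤-<-trans i≤t t<)
          in x , y , e , trans
               (fromℕ<-cong _ _
                 (trans (cong (λ xy → uncurry code xy ⊓ t) (orient-∈ x∈X))
                   (trans (cong (_⊓ t) eq) (m≤n⇒m⊓n≡m i≤t))) _ (toℕ<n i))
               (fromℕ<-toℕ i _)
      }

    -- The ranks of the `m + 2` ends in `X`, truncated at `m`, take at most `m + 1` values, so two
    -- edges of the copy collide. Either they have the same end in `X`, impossible in a matching, or
    -- both ranks are at least `m` and both edges have colour `t`, impossible in a rainbow copy.
    -- Allowing every `t ≤ m * k` excludes all smaller numbers of colours too.
    ¬forces : ∀ {m t} → m < ∣ X ∣ → t ≤ m * k → ¬ Forces B (suc (suc m) K₂) (suc t)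
    ¬forces {m} {t} m<∣X∣ t≤mk F with F (colouring (≤-<-trans t≤mk (*-monoˡ-< k m<∣X∣)))
    ... | φ , rainbow = contradiction (level-injective (⊓-cancelʳ (fromℕ<-injective _ _ _ _ (proj₂ (proj₂ (proj₂ collision)))))) (<⇒≢ i<j)
      where
      open Copy φ
      left right xEnd : Fin (suc (suc m)) → Vertex
      left  a = vertex (combine {suc (suc m)} {2} a zero)
      right a = vertex (combine {suc (suc m)} {2} a (suc zero))
      xEnd  a = proj₁ (orient (left a) (right a))
      left~right : ∀ a → left a ~ right a
      left~right a = edge (K₂-pair a)

      level : Fin (suc (suc m)) → ℕ
      level a = rank X (xEnd a)
      collision = pigeonhole (n<1+n _) (λ a → fromℕ< (s≤s (m⊓n≤n (level a) m)))
      i = proj₁ collision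
      j = proj₁ (proj₂ collision)
      i<j = proj₁ (proj₂ (proj₂ collision))

      xEnd-vertex : ∀ a → ∃ λ (s : Fin 2) → xEnd a ≡ vertex (combine a s)
      xEnd-vertex a with orient-end (left a) (right a)
      ... | inj₁ eq = zero , eq
      ... | inj₂ eq = suc zero , eq

      xEnd-injective : ∀ {a b} → xEnd a ≡ xEnd b → a ≡ b
      xEnd-injective {a} {b} eq =
        let s , p = xEnd-vertex a
            t , q = xEnd-vertex b
        in proj₁ (combine-injective a s b t (injective (trans (sym p) (trans eq q))))

      last-colour : ∀ a → m ≤ level a → truncatedColour t (left a) (right a) ≡ t
      -- A rank of at least `m` makes the code at least `m * k`, hence at least `t`.
      last-colour a l = m≥n⇒m⊓n≡n (≤-trans t≤mk (≤-trans (*-monoˡ-≤ k l) (m≤n+m _ _)))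

      level-injective : ∀ {a b} → level a ≡ level b ⊎ (m ≤ level a × m ≤ level b) → a ≡ b
      level-injective {a} {b} (inj₁ eq) =
        xEnd-injective (rank-injective X (orient-X (left~right a)) (orient-X (left~right b)) eq)
      level-injective {a} {b} (inj₂ (p , q))
        with rainbow (K₂-pair a) (K₂-pair b)
               (fromℕ<-cong _ _ (trans (last-colour a p) (sym (last-colour b q))) _ _)
      ... | inj₁ (eq , _) = proj₁ (combine-injective a _ b _ eq)
      ... | inj₂ (eq , _) = proj₁ (combine-injective a _ b _ eq)

-- The two bounds over the integers.

open import Data.Integer.Base as ℤ using (+_)

theorem2p4 : (n k m : ℕ) → 1 ≤ k → k ≤ n → 1 ≤ m → m ≤ n →
    (B : Graph) (X Y : Subset (Graph.order B)) →
    IsBipartition B X Y → ∣ X ∣ ≡ n → ∣ Y ∣ ≡ n → IsRegular B k →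
    ((+ k ℤ.* (+ m ℤ.- + 2)) ℤ.+ + 2 ℤ.≤ + rb B (m K₂))
    × (+ rb B (m K₂) ℤ.≤ (+ k ℤ.* (+ m ℤ.- + 1)) ℤ.+ + 1)
theorem2p4 n k (suc m) 1≤k k≤n 1≤m m≤n B X Y bip refl _ regular = lower m m≤n , upper
  where
  instance
    k≢0 : NonZero k
    k≢0 = >-nonZero 1≤k

  upper : + rb B (suc m K₂) ℤ.≤ (+ k ℤ.* (+ suc m ℤ.- + 1)) ℤ.+ + 1
  -- `+ suc m - + 1` computes to `+ m`, so only the product has to be carried over from the
  -- naturals.
  upper = subst (λ z → + rb B (suc m K₂) ℤ.≤ z ℤ.+ + 1) (ℤₚ.pos-* k m)
    (ℤ.+≤+ (IsRainbowNumber.minimal (rb-isRainbowNumber B (suc m K₂)) (k * m + 1) (m≤n+m 1 (k * m))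
      (rainbow-matching bip (λ v → ≤-reflexive (regular v)) (≤-reflexive (+-comm 1 (k * m))))))

  lower : ∀ m → suc m ≤ ∣ X ∣ → (+ k ℤ.* (+ suc m ℤ.- + 2)) ℤ.+ + 2 ℤ.≤ + rb B (suc m K₂)
  -- For a single edge the bound is `2 - k`, which is at most 1 since `1 ≤ k`, and a rainbow number
  -- is positive.
  lower zero _ = ℤₚ.≤-trans
    (ℤₚ.≤-trans (ℤₚ.≤-reflexive (trans (cong (ℤ._+ + 2) (trans (ℤₚ.*-comm (+ k) (ℤ.- + 1)) (ℤₚ.-1*i≡-i (+ k)))) (ℤₚ.+-comm (ℤ.- + k) (+ 2))))
      (ℤₚ.+-monoʳ-≤ (+ 2) (ℤₚ.neg-mono-≤ (ℤ.+≤+ 1≤k))))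
    (ℤ.+≤+ (IsRainbowNumber.positive (rb-isRainbowNumber B (suc zero K₂))))
  lower (suc m) m<∣X∣ = subst (λ z → z ℤ.+ + 2 ℤ.≤ + rb B (suc (suc m) K₂)) (ℤₚ.pos-* k m)
    (ℤ.+≤+ (bound (rb B (suc (suc m) K₂)) (IsRainbowNumber.positive N) (IsRainbowNumber.forces N)))
    where
    N = rb-isRainbowNumber B (suc (suc m) K₂)
    bound : ∀ r → 1 ≤ r → Forces B (suc (suc m) K₂) r → k * m + 2 ≤ r
    -- If `suc t` colours force the matching, then `t` exceeds `m * k`; the two successors make up
    -- the summand 2.
    bound (suc t) _ F with t ≤? m * k
    ... | yes t≤mk = contradiction F (¬forces bip regular (≤-trans (n≤1+n (suc m)) m<∣X∣) t≤mk)
    ... | no  t≰mk = ≤-trans (≤-reflexive (trans (+-comm (k * m) 2) (cong (λ z → suc (suc z)) (*-comm k m)))) (s≤s (≰⇒> t≰mk))
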